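{- Let $m,n\ge 1$ and let $K_{m,n}$ be the complete bipartite graph with parts $\{1,\dots,m\}$ and $\{m+1,\dots,m+n\}$. For $1\le k\le m$, let $\mathfrak{T}^k_{m+n}$ be the set of spanning trees of $K_{m,n}$, rooted at $m+n$, which are uprooted (the root $m+n$ is larger than all of its children, automatically true here) and in which the highest (largest) child of the root $m+n$ equals $m+1-k$. Then \[|\mathfrak{T}^k_{m+n}| = m^{n-2}\, n^{m-k-1}\,(n-1)^{k-1}\,(m+n-k).\]
   Context: A rooted tree is oriented away from its root; the children of the root are its neighbours in the tree. An uprooted tree is a rooted tree whose root is greater than all of its children. -}

module Defs where

open import Data.Nat using (ℕ; zero; suc; _+_; _∸_; _≤_; _<_)
open import Data.Fin using (Fin; toℕ; splitAt)
open import Data.Bool using (Bool; true; false)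
open import Data.Vec using (Vec; lookup)
open import Data.Sum using (_⊎_; inj₁; inj₂)
open import Data.Product using (Σ; ∃; ∃-syntax; _×_)
open import Data.Empty using (⊥)
open import Data.List using (List; _∷_; _∷ʳ_; length)
open import Data.List.Relation.Unary.Unique.Propositional using (Unique)
open import Data.List.Relation.Unary.Linked using (Linked)
open import Relation.Binary.PropositionalEquality using (_≡_)
open import Relation.Nullary using (¬_)

-- Vertices of K_{m,n}: Fin (m + n); vertex i (0-based) is the paper's vertex i+1.
-- Vertices with toℕ < m form the part {1..m}, the others the part {m+1..m+n}.
Vertex : ℕ → ℕ → Set
Vertex m n = Fin (m + n)

-- A set of edges of K_{m,n}: entry (a , b) says whether the edge between
-- paper-vertex a+1 and paper-vertex m+b+1 is present.
EdgeSet : ℕ → ℕ → Set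
EdgeSet m n = Vec (Vec Bool n) m

Adj' : ∀ {m n} → EdgeSet m n → Fin m ⊎ Fin n → Fin m ⊎ Fin n → Set
Adj' E (inj₁ a) (inj₂ b) = lookup (lookup E a) b ≡ true
Adj' E (inj₂ b) (inj₁ a) = lookup (lookup E a) b ≡ true
Adj' E _ _ = ⊥

Adj : ∀ {m n} → EdgeSet m n → Vertex m n → Vertex m n → Set
Adj {m} {n} E u v = Adj' E (splitAt m u) (splitAt m v)

data Walk {m n} (E : EdgeSet m n) : Vertex m n → Vertex m n → Set where
  here : ∀ {u} → Walk E u u
  step : ∀ {u v w} → Adj E u v → Walk E v w → Walk E u w

Connected : ∀ {m n} → EdgeSet m n → Set
Connected E = ∀ u v → Walk E u v

HasCycle : ∀ {m n} → EdgeSet m n → Set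
HasCycle {m} {n} E =
  ∃[ v ] ∃[ ws ] (2 ≤ length ws × Unique {A = Vertex m n} (v ∷ ws) × Linked (Adj E) (v ∷ (ws ∷ʳ v)))

IsSpanningTree : ∀ {m n} → EdgeSet m n → Set
IsSpanningTree E = Connected E × ¬ HasCycle E

-- The tree is rooted at vertex r; children of r are its neighbours.
-- Uprooted: r is greater than all of its children.
Uprooted : ∀ {m n} → EdgeSet m n → Vertex m n → Set
Uprooted E r = ∀ v → Adj E r v → toℕ v < toℕ r

HighestChild : ∀ {m n} → EdgeSet m n → Vertex m n → Vertex m n → Set
HighestChild E r c = Adj E r c × (∀ v → Adj E r v → toℕ v ≤ toℕ c)

-- membership in 𝔗^k_{m+n}: spanning tree of K_{m,n}, rooted at paper-vertex m+n
-- (0-based index m+n-1), uprooted, whose highest child of the root is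
-- paper-vertex m+1-k (0-based index m-k).
InT : (m n k : ℕ) → EdgeSet m n → Set
InT m n k E =
  IsSpanningTree E ×
  ∃[ r ] ∃[ c ] (toℕ r ≡ (m + n) ∸ 1 × toℕ c ≡ m ∸ k × Uprooted E r × HighestChild E r c)

record 𝔗 (m n k : ℕ) : Set where
  constructor tree
  field
    edges : EdgeSet m n
    .isIn : InT m n k edges

{-# OPTIONS --safe #-}
-- Orienting a spanning tree towards its root m + n turns it into a pair of parent functions: f on the
-- left part and g on the right vertices other than the root, such that following parents always ends
-- at the root. Given f, the left vertices fall into classes according to their parent, and g is counted
-- by contracting one right vertex at a time into the class of its parent: if i left vertices have the
-- root as parent, there are i * m ^ (n - 2) suitable g. The highest child of the root is m + 1 - k iff f sends
-- that vertex to the root, the k - 1 later ones elsewhere, and the m - k earlier ones anywhere, and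
-- i summed over these f is n ^ (m - k - 1) * (n - 1) ^ (k - 1) * (m + n - k).
module Submission where

open import Defs
open import Data.Nat using (ℕ; zero; suc; _+_; _*_; _∸_; _^_; _≤_; _<_; z≤n; s≤s)
import Data.Nat.Properties as ℕₚ
open import Data.Nat.Tactic.RingSolver using (solve-∀)
open import Data.Bool using (true)
import Data.Bool.Properties as Boolₚ
open import Data.Fin using (Fin; zero; suc; toℕ; fromℕ; inject₁; splitAt; join; _↑ˡ_; _↑ʳ_)
import Data.Fin.Properties as Finₚ
open import Data.Fin.Relation.Unary.Top using (view; ‵fromℕ; ‵inj₁)
open import Data.List as List using (List; []; _∷_; _∷ʳ_; _++_; map; length; concatMap; cartesianProductWith; allFin)
import Data.List.Properties as Listₚ
import Data.List.Membership.DecPropositional as DecMembership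
open import Data.List.Membership.Propositional using (_∈_; find; lose)
open import Data.List.Membership.Propositional.Properties using (∈-map⁺; ∈-map⁻; ∈-allFin; ∈-concatMap⁺; ∈-concatMap⁻; ∈-cartesianProductWith⁺; ∈-cartesianProductWith⁻; ∈-lookup)
open import Data.List.Relation.Unary.Any using (here; there; index; any?)
open import Data.List.Relation.Unary.Any.Properties using (lookup-index)
open import Data.List.Relation.Unary.All as All using (All; []; _∷_)
import Data.List.Relation.Unary.All.Properties as Allₚ
open import Data.List.Relation.Unary.AllPairs as AllPairs using ([]; _∷_)
import Data.List.Relation.Unary.AllPairs.Properties as AllPairsₚ
open import Data.List.Relation.Unary.Linked as Linked using (Linked; [-]; _∷_)
open import Data.List.Relation.Unary.Unique.Propositional using (Unique)
import Data.List.Relation.Unary.Unique.Propositional.Properties as Uniqueₚ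
open import Data.Maybe using (Maybe; just; nothing)
import Data.Maybe.Properties as Maybeₚ
open import Data.Vec as Vec using (Vec; []; _∷_; lookup)
import Data.Vec.Properties as Vecₚ
open import Data.Product using (∃-syntax; _×_; _,_; proj₁; proj₂)
open import Data.Sum using (_⊎_; inj₁; inj₂; swap)
import Data.Sum.Properties as Sumₚ
open import Data.Empty using (⊥; ⊥-elim)
open import Function using (_∘_; id; mk⇔)
open import Function.Bundles using (_⤖_; mk⤖)
open import Relation.Nullary using (¬_; Dec; yes; no; does; recompute)
open import Relation.Nullary.Decidable using (_⊎-dec_; _×-dec_; dec-true)
open import Relation.Binary.PropositionalEquality using (_≡_; _≢_; refl; sym; trans; cong; cong₂; subst; subst₂; module ≡-Reasoning)

private
  variable
    m n r : ℕ
    A B : Set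

-- Finite sums over lists, and lists without repetition.

∑ : List A → (A → ℕ) → ℕ
∑ [] φ = 0
∑ (x ∷ xs) φ = φ x + ∑ xs φ

∑-cong : (xs : List A) {φ ψ : A → ℕ} → (∀ x → φ x ≡ ψ x) → ∑ xs φ ≡ ∑ xs ψ
∑-cong [] eq = refl
∑-cong (x ∷ xs) eq = cong₂ _+_ (eq x) (∑-cong xs eq)

∑-+ : (xs : List A) (φ ψ : A → ℕ) → ∑ xs (λ x → φ x + ψ x) ≡ ∑ xs φ + ∑ xs ψ
∑-+ [] φ ψ = refl
∑-+ (x ∷ xs) φ ψ rewrite ∑-+ xs φ ψ = interchange (φ x) (ψ x) (∑ xs φ) (∑ xs ψ)
  where
  interchange : ∀ a b c d → a + b + (c + d) ≡ a + c + (b + d)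
  interchange = solve-∀

∑-*ʳ : (xs : List A) (φ : A → ℕ) (c : ℕ) → ∑ xs (λ x → φ x * c) ≡ ∑ xs φ * c
∑-*ʳ [] φ c = refl
∑-*ʳ (x ∷ xs) φ c rewrite ∑-*ʳ xs φ c = sym (ℕₚ.*-distribʳ-+ c (φ x) (∑ xs φ))

∑-const : (xs : List A) (c : ℕ) → ∑ xs (λ _ → c) ≡ length xs * c
∑-const [] c = refl
∑-const (x ∷ xs) c = cong (c +_) (∑-const xs c)

∑-++ : (xs ys : List A) (φ : A → ℕ) → ∑ (xs ++ ys) φ ≡ ∑ xs φ + ∑ ys φ
∑-++ [] ys φ = refl
∑-++ (x ∷ xs) ys φ rewrite ∑-++ xs ys φ = sym (ℕₚ.+-assoc (φ x) (∑ xs φ) (∑ ys φ))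

∑-map : (h : A → B) (xs : List A) (φ : B → ℕ) → ∑ (map h xs) φ ≡ ∑ xs (φ ∘ h)
∑-map h [] φ = refl
∑-map h (x ∷ xs) φ = cong (φ (h x) +_) (∑-map h xs φ)

∑-allFin-suc : (φ : Fin (suc n) → ℕ) → ∑ (allFin (suc n)) φ ≡ φ zero + ∑ (allFin n) (φ ∘ suc)
∑-allFin-suc {n} φ = cong (φ zero +_)
  (trans (cong (λ xs → ∑ xs φ) (sym (Listₚ.map-tabulate id suc))) (∑-map suc (allFin n) φ))

length-concatMap : (h : A → List B) (xs : List A) → length (concatMap h xs) ≡ ∑ xs (length ∘ h)
length-concatMap h [] = refl
length-concatMap h (x ∷ xs) =
  trans (Listₚ.length-++ (h x)) (cong (length (h x) +_) (length-concatMap h xs))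

length-cartesianProductWith : ∀ {C : Set} (h : A → B → C) xs ys →
  length (cartesianProductWith h xs ys) ≡ length xs * length ys
length-cartesianProductWith h [] ys = refl
length-cartesianProductWith h (x ∷ xs) ys = trans (Listₚ.length-++ (map (h x) ys))
  (cong₂ _+_ (Listₚ.length-map (h x) ys) (length-cartesianProductWith h xs ys))

length-allFin : ∀ n → length (allFin n) ≡ n
length-allFin n = Listₚ.length-tabulate id

-- Injectivity is asked for on members only, because `edges f` will be shown injective on the
-- vectors listed in `goods`.
map-unique : {h : A → B} {xs : List A} →
  (∀ {x y} → x ∈ xs → y ∈ xs → h x ≡ h y → x ≡ y) → Unique xs → Unique (map h xs)
map-unique inj [] = []
map-unique inj (x∉xs ∷ u) =
  Allₚ.map⁺ (All.tabulate λ y∈xs eq → All.lookup x∉xs y∈xs (inj (here refl) (there y∈xs) eq))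
  ∷ map-unique (λ p q → inj (there p) (there q)) u

concatMap-unique : {h : A → List B} {xs : List A} → (∀ x → Unique (h x)) →
  (∀ {x y z} → z ∈ h x → z ∈ h y → x ≡ y) → Unique xs → Unique (concatMap h xs)
concatMap-unique each inj u = Uniqueₚ.concat⁺ (Allₚ.map⁺ (All.tabulate λ {x} _ → each x))
  (AllPairsₚ.map⁺ (AllPairs.map (λ x≢y {z} (p , q) → x≢y (inj p q)) u))

-- Parent functions, reachability of the root, and contraction.

-- The last right vertex is the root of the tree.
par : Vec (Fin m) r → Fin (suc r) → Maybe (Fin m)
par [] zero = nothing
par (a ∷ g) zero = just a
par (a ∷ g) (suc b) = par g b

-- `c a` is the right vertex, or after contractions the class, that is the parent of `a`. An
-- arbitrary function is allowed so that contraction, which composes `c` with `merge d`, stays in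
-- the same setting. Being inductive, `Reach` excludes parent chains that run in a cycle.
data Reach {m r} (c : Fin m → Fin (suc r)) (g : Vec (Fin m) r) : Fin (suc r) → Set where
  root : ∀ {b} → par g b ≡ nothing → Reach c g b
  via : ∀ {b a} → par g b ≡ just a → Reach c g (c a) → Reach c g b

-- Identifies class 0 with class suc d and renumbers the classes.
merge : Fin (suc r) → Fin (suc (suc r)) → Fin (suc r)
merge d zero = d
merge d (suc b) = b

steps : {c : Fin m → Fin (suc r)} {g : Vec (Fin m) r} {b : Fin (suc r)} → Reach c g b → ℕ
steps (root _) = 0
steps (via _ ρ) = suc (steps ρ)

-- The chain of parents is deterministic: `par g b` decides which constructor applies and which `a`
-- comes next.
steps-irrelevant : {c : Fin m → Fin (suc r)} {g : Vec (Fin m) r} {b : Fin (suc r)} →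
  (ρ σ : Reach c g b) → steps ρ ≡ steps σ
steps-irrelevant (root _) (root _) = refl
steps-irrelevant (root p) (via q _) with () ← trans (sym p) q
steps-irrelevant (via p _) (root q) with () ← trans (sym p) q
steps-irrelevant (via p ρ) (via q σ) with refl ← trans (sym p) q = cong suc (steps-irrelevant ρ σ)

-- If `b` is its own grandparent, a derivation for `b` contains a strictly shorter one for `b`,
-- against the uniqueness of the step count.
no-loop : {c : Fin m → Fin (suc r)} {g : Vec (Fin m) r} {b : Fin (suc r)} {a : Fin m} →
  par g b ≡ just a → c a ≡ b → ¬ Reach c g b
no-loop eq refl (root none) with () ← trans (sym eq) none
no-loop eq refl ρ@(via eq′ σ) with refl ← trans (sym eq) eq′ =
  ℕₚ.1+n≢n (steps-irrelevant ρ σ)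

-- Right vertex `zero` has grandparent `suc d`. Contraction identifies the two, so the step between
-- them disappears from the chain and all other steps survive.
reach-merge : {c : Fin m → Fin (suc (suc r))} {g : Vec (Fin m) r} {a : Fin m} {d : Fin (suc r)} →
  c a ≡ suc d → ∀ {b} → Reach c (a ∷ g) b → Reach (merge d ∘ c) g (merge d b)
reach-merge ca {zero} (via {a = a} refl ρ) = subst (Reach _ _) (cong (merge _) ca) (reach-merge ca ρ)
reach-merge ca {suc b} (root none) = root none
reach-merge ca {suc b} (via eq ρ) = via eq (reach-merge ca ρ)

reach-unmerge : {c : Fin m → Fin (suc (suc r))} {g : Vec (Fin m) r} {a : Fin m} {d : Fin (suc r)} →
  c a ≡ suc d → ∀ {b} → Reach (merge d ∘ c) g b → Reach c (a ∷ g) (suc b)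
reach-unmerge ca (root none) = root none
reach-unmerge {c = c} {g} {a} {d} ca (via {a = a′} eq ρ) = via eq (lift (c a′) (reach-unmerge ca ρ))
  where
  -- When the chain enters class `zero`, the step from `zero` to `suc d` that contraction removed is
  -- put back.
  lift : ∀ e → Reach c (a ∷ g) (suc (merge d e)) → Reach c (a ∷ g) e
  lift zero σ = via refl (subst (Reach _ _) (sym ca) σ)
  lift (suc e) σ = σ

-- Enumeration of the parent functions g for a given f.

goods : (c : Fin m → Fin (suc r)) → List (Vec (Fin m) r)
-- Right vertex `zero` gets the parent `a`, is contracted into the class of `a`, and the recursion
-- continues. That class is a separate argument so that it can be matched on; class `zero` is
-- inadmissible, as the vertex would become its own grandparent.
branch : (c : Fin m → Fin (suc (suc r))) → Fin m → Fin (suc (suc r)) → List (Vec (Fin m) (suc r))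
goods {r = zero} c = [] ∷ []
goods {r = suc r} c = concatMap (λ a → branch c a (c a)) (allFin _)
branch c a zero = []
branch c a (suc d) = map (a ∷_) (goods (merge d ∘ c))

branch-head : (c : Fin m → Fin (suc (suc r))) {a : Fin m} {g : Vec (Fin m) (suc r)}
  (e : Fin (suc (suc r))) → g ∈ branch c a e → Vec.head g ≡ a
branch-head c (suc d) p with _ , _ , refl ← ∈-map⁻ _ p = refl

goods-unique : (c : Fin m → Fin (suc r)) → Unique (goods c)
branch-unique : (c : Fin m → Fin (suc (suc r))) (a : Fin m) (e : Fin (suc (suc r))) → Unique (branch c a e)
goods-unique {r = zero} c = [] ∷ []
goods-unique {r = suc r} c = concatMap-unique (λ a → branch-unique c a (c a))
  (λ {a} {a′} p q → trans (sym (branch-head c (c a) p)) (branch-head c (c a′) q))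
  (Uniqueₚ.allFin⁺ _)
branch-unique c a zero = []
branch-unique c a (suc d) = Uniqueₚ.map⁺ Vecₚ.∷-injectiveʳ (goods-unique (merge d ∘ c))

goods-sound : (c : Fin m → Fin (suc r)) {g : Vec (Fin m) r} → g ∈ goods c → ∀ b → Reach c g b
goods-sound {r = zero} c {[]} _ zero = root refl
goods-sound {r = suc r} c g∈ b
  with a , _ , p ← find (∈-concatMap⁻ (λ a → branch c a (c a)) {xs = allFin _} g∈)
  with c a in ca
... | suc d with g , q , refl ← ∈-map⁻ _ p = lift b
  where
  tail-sound : ∀ b → Reach (merge d ∘ c) g b
  tail-sound = goods-sound (merge d ∘ c) q
  lift : ∀ b → Reach c (a ∷ g) b
  lift zero = via refl (subst (Reach _ _) (sym ca) (reach-unmerge ca (tail-sound d)))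
  lift (suc b) = reach-unmerge ca (tail-sound b)

goods-complete : (c : Fin m → Fin (suc r)) (g : Vec (Fin m) r) → (∀ b → Reach c g b) → g ∈ goods c
goods-complete {r = zero} c [] _ = here refl
goods-complete {r = suc r} c (a ∷ g) ρ =
  ∈-concatMap⁺ (λ a → branch c a (c a)) (lose (∈-allFin a) (∈-branch (c a) refl))
  where
  ∈-branch : ∀ e → c a ≡ e → a ∷ g ∈ branch c a e
  ∈-branch zero ca = ⊥-elim (no-loop refl ca (ρ zero))
  ∈-branch (suc d) ca = ∈-map⁺ (a ∷_) (goods-complete _ g λ b → reach-merge ca (ρ (suc b)))

-- The number of parent functions g for a given f.

isLast : Fin (suc r) → ℕ
isLast {zero} zero = 1
isLast {suc r} zero = 0
isLast {suc r} (suc b) = isLast b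

isZero : Fin (suc r) → ℕ
isZero zero = 1
isZero (suc _) = 0

rootClass : (Fin m → Fin (suc r)) → ℕ
rootClass c = ∑ (allFin _) (isLast ∘ c)

-- Class `zero` moves as a whole into class `d`, so it joins the root class exactly when `d` is
-- last.
rootClass-merge : (c : Fin m → Fin (suc (suc r))) (d : Fin (suc r)) →
  rootClass (merge d ∘ c) ≡ rootClass c + ∑ (allFin m) (isZero ∘ c) * isLast d
rootClass-merge c d = begin
  ∑ xs (isLast ∘ merge d ∘ c)                             ≡⟨ ∑-cong xs (pointwise ∘ c) ⟩
  ∑ xs (λ x → isLast (c x) + isZero (c x) * isLast d)     ≡⟨ ∑-+ xs (isLast ∘ c) _ ⟩
  rootClass c + ∑ xs (λ x → isZero (c x) * isLast d)      ≡⟨ cong (rootClass c +_) (∑-*ʳ xs (isZero ∘ c) (isLast d)) ⟩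
  rootClass c + ∑ xs (isZero ∘ c) * isLast d              ∎
  where
  open ≡-Reasoning
  xs = allFin _
  pointwise : ∀ e → isLast (merge d e) ≡ isLast e + isZero e * isLast d
  pointwise zero = sym (ℕₚ.+-identityʳ (isLast d))
  pointwise (suc e) = sym (ℕₚ.+-identityʳ (isLast e))

-- Contracting vertex 0 into its parent a leaves rootClass + (size of class 0 if a is in the root
-- class) root elements; these sum over the admissible a to rootClass * m.
length-goods : (c : Fin m → Fin (suc r)) → length (goods c) * m ≡ rootClass c * m ^ r
length-goods {m} {zero} c = begin
  1 * m                          ≡⟨ ℕₚ.*-comm 1 m ⟩
  m * 1                          ≡⟨ cong (_* 1) (length-allFin m) ⟨
  length (allFin m) * 1          ≡⟨ ∑-const (allFin m) 1 ⟨
  ∑ (allFin m) (λ _ → 1)         ≡⟨ ∑-cong (allFin m) (one ∘ c) ⟩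
  rootClass c                    ≡⟨ ℕₚ.*-identityʳ _ ⟨
  rootClass c * 1                ∎
  where
  open ≡-Reasoning
  one : (x : Fin 1) → 1 ≡ isLast x
  one zero = refl
length-goods {m} {suc r} c = begin
  length (goods c) * m                         ≡⟨ cong (_* m) (length-concatMap _ xs) ⟩
  ∑ xs (λ a → length (branch c a (c a))) * m   ≡⟨ ∑-*ʳ xs _ m ⟨
  ∑ xs (λ a → length (branch c a (c a)) * m)   ≡⟨ ∑-cong xs (λ a → length-branch a (c a)) ⟩
  ∑ xs (λ a → φ (c a) * m ^ r)                 ≡⟨ ∑-*ʳ xs (φ ∘ c) (m ^ r) ⟩
  ∑ xs (φ ∘ c) * m ^ r                         ≡⟨ cong (_* m ^ r) ∑-φ ⟩
  rootClass c * m * m ^ r                      ≡⟨ ℕₚ.*-assoc (rootClass c) m (m ^ r) ⟩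
  rootClass c * (m * m ^ r)                    ∎
  where
  open ≡-Reasoning
  xs = allFin m
  s = ∑ xs (isZero ∘ c)
  i = rootClass c
  φ : Fin (suc (suc r)) → ℕ
  φ zero = 0
  φ (suc d) = rootClass (merge d ∘ c)
  length-branch : ∀ a e → length (branch c a e) * m ≡ φ e * m ^ r
  length-branch a zero = refl
  length-branch a (suc d) = trans (cong (_* m) (Listₚ.length-map (a ∷_) (goods (merge d ∘ c))))
    (length-goods (merge d ∘ c))
  -- Inadmissible `a` contribute 0 to `φ`. Crediting them with `i` makes the right-hand side uniform
  -- in `e` and avoids subtraction.
  pointwise : ∀ e → φ e + isZero e * i ≡ i + isLast e * s
  pointwise zero = refl
  pointwise (suc d) = trans (ℕₚ.+-identityʳ _)
    (trans (rootClass-merge c d) (cong (i +_) (ℕₚ.*-comm s (isLast d))))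
  ∑-φ : ∑ xs (φ ∘ c) ≡ i * m
  -- The cancelled `s * i` is the total credit of the `s` inadmissible choices. It equals the total
  -- gain `i * s` from the `i` choices of `a` in the root class.
  ∑-φ = ℕₚ.+-cancelʳ-≡ (s * i) _ _ (begin
    ∑ xs (φ ∘ c) + s * i                                 ≡⟨ cong (∑ xs (φ ∘ c) +_) (∑-*ʳ xs (isZero ∘ c) i) ⟨
    ∑ xs (φ ∘ c) + ∑ xs (λ x → isZero (c x) * i)         ≡⟨ ∑-+ xs (φ ∘ c) _ ⟨
    ∑ xs (λ x → φ (c x) + isZero (c x) * i)              ≡⟨ ∑-cong xs (pointwise ∘ c) ⟩
    ∑ xs (λ x → i + isLast (c x) * s)                    ≡⟨ ∑-+ xs (λ _ → i) _ ⟩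
    ∑ xs (λ _ → i) + ∑ xs (λ x → isLast (c x) * s)       ≡⟨ cong₂ _+_ (∑-const xs i) (∑-*ʳ xs (isLast ∘ c) s) ⟩
    length xs * i + i * s                                ≡⟨ cong (λ l → l * i + i * s) (length-allFin m) ⟩
    m * i + i * s                                        ≡⟨ cong₂ _+_ (ℕₚ.*-comm m i) (ℕₚ.*-comm i s) ⟩
    i * m + s * i                                        ∎)

-- Enumeration and weighted count of the parent functions f.

avoiding : ∀ r K → List (Vec (Fin (suc r)) K)
avoiding r zero = [] ∷ []
avoiding r (suc K) = cartesianProductWith _∷_ (map inject₁ (allFin r)) (avoiding r K)

-- Here `suc r` is n, `M` is m - k and `K` is k - 1: first come `M` free values, then the highest
-- child of the root, then `K` values other than the root `fromℕ r`.
tops : ∀ r M K → List (Vec (Fin (suc r)) (M + suc K))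
tops r zero K = map (fromℕ r ∷_) (avoiding r K)
tops r (suc M) K = cartesianProductWith _∷_ (allFin (suc r)) (tops r M K)

∷-unique : {xs : List A} {ys : List (Vec A n)} → Unique xs → Unique ys → Unique (cartesianProductWith _∷_ xs ys)
∷-unique = Uniqueₚ.cartesianProductWith⁺ _∷_ Vecₚ.∷-injective

avoiding-unique : ∀ r K → Unique (avoiding r K)
avoiding-unique r zero = [] ∷ []
avoiding-unique r (suc K) =
  ∷-unique (Uniqueₚ.map⁺ Finₚ.inject₁-injective (Uniqueₚ.allFin⁺ r)) (avoiding-unique r K)

tops-unique : ∀ r M K → Unique (tops r M K)
tops-unique r zero K = Uniqueₚ.map⁺ Vecₚ.∷-injectiveʳ (avoiding-unique r K)
tops-unique r (suc M) K = ∷-unique (Uniqueₚ.allFin⁺ (suc r)) (tops-unique r M K)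

rootClass-∷ : (x : Fin (suc r)) (f : Vec (Fin (suc r)) m) →
  rootClass (lookup (x ∷ f)) ≡ isLast x + rootClass (lookup f)
rootClass-∷ x f = ∑-allFin-suc (isLast ∘ lookup (x ∷ f))

-- `rootClass` is additive in head and tail; each head occurs with every tail and each tail with
-- every head.
∑-rootClass-∷ : (xs : List (Fin (suc r))) (fs : List (Vec (Fin (suc r)) m)) →
  ∑ (cartesianProductWith _∷_ xs fs) (rootClass ∘ lookup) ≡
  ∑ xs isLast * length fs + length xs * ∑ fs (rootClass ∘ lookup)
∑-rootClass-∷ [] fs = refl
∑-rootClass-∷ (x ∷ xs) fs = begin
  ∑ (map (x ∷_) fs ++ cartesianProductWith _∷_ xs fs) ω
    ≡⟨ ∑-++ (map (x ∷_) fs) _ ω ⟩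
  ∑ (map (x ∷_) fs) ω + ∑ (cartesianProductWith _∷_ xs fs) ω
    ≡⟨ cong₂ _+_ (trans (∑-map (x ∷_) fs ω) (∑-cong fs (rootClass-∷ x))) (∑-rootClass-∷ xs fs) ⟩
  ∑ fs (λ f → isLast x + ω f) + (∑ xs isLast * length fs + length xs * ∑ fs ω)
    ≡⟨ cong (_+ _) (trans (∑-+ fs (λ _ → isLast x) ω) (cong (_+ ∑ fs ω) (∑-const fs (isLast x)))) ⟩
  length fs * isLast x + ∑ fs ω + (∑ xs isLast * length fs + length xs * ∑ fs ω)
    ≡⟨ regroup (length fs) (isLast x) (∑ fs ω) (∑ xs isLast) (length xs) ⟩
  (isLast x + ∑ xs isLast) * length fs + (∑ fs ω + length xs * ∑ fs ω) ∎
  where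
  open ≡-Reasoning
  ω : ∀ {m} → Vec (Fin _) m → ℕ
  ω = rootClass ∘ lookup
  regroup : ∀ l x w t k → l * x + w + (t * l + k * w) ≡ (x + t) * l + (w + k * w)
  regroup = solve-∀

isLast-fromℕ : ∀ r → isLast (fromℕ r) ≡ 1
isLast-fromℕ zero = refl
isLast-fromℕ (suc r) = isLast-fromℕ r

isLast-inject₁ : (b : Fin r) → isLast (inject₁ b) ≡ 0
isLast-inject₁ zero = refl
isLast-inject₁ (suc b) = isLast-inject₁ b

∑-isLast : ∀ r → ∑ (allFin (suc r)) isLast ≡ 1
∑-isLast zero = refl
∑-isLast (suc r) = trans (∑-allFin-suc {suc r} isLast) (∑-isLast r)

∑-isLast-inject₁ : ∀ r → ∑ (map inject₁ (allFin r)) isLast ≡ 0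
∑-isLast-inject₁ r = begin
  ∑ (map inject₁ (allFin r)) isLast      ≡⟨ ∑-map inject₁ (allFin r) isLast ⟩
  ∑ (allFin r) (isLast ∘ inject₁)        ≡⟨ ∑-cong (allFin r) isLast-inject₁ ⟩
  ∑ (allFin r) (λ _ → 0)                 ≡⟨ ∑-const (allFin r) 0 ⟩
  length (allFin r) * 0                  ≡⟨ ℕₚ.*-zeroʳ (length (allFin r)) ⟩
  0                                      ∎
  where open ≡-Reasoning

length-avoiding : ∀ r K → length (avoiding r K) ≡ r ^ K
length-avoiding r zero = refl
length-avoiding r (suc K) = trans (length-cartesianProductWith _∷_ (map inject₁ (allFin r)) (avoiding r K))
  (cong₂ _*_ (trans (Listₚ.length-map inject₁ (allFin r)) (length-allFin r)) (length-avoiding r K))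

∑-avoiding : ∀ r K → ∑ (avoiding r K) (rootClass ∘ lookup) ≡ 0
∑-avoiding r zero = refl
∑-avoiding r (suc K) = trans (∑-rootClass-∷ (map inject₁ (allFin r)) (avoiding r K))
  (cong₂ _+_ (cong (_* length (avoiding r K)) (∑-isLast-inject₁ r))
    (trans (cong (length (map inject₁ (allFin r)) *_) (∑-avoiding r K)) (ℕₚ.*-zeroʳ (length (map inject₁ (allFin r))))))

length-tops : ∀ r M K → length (tops r M K) ≡ suc r ^ M * r ^ K
length-tops r zero K = begin
  length (map (fromℕ r ∷_) (avoiding r K))  ≡⟨ Listₚ.length-map (fromℕ r ∷_) (avoiding r K) ⟩
  length (avoiding r K)                     ≡⟨ length-avoiding r K ⟩
  r ^ K                                     ≡⟨ ℕₚ.*-identityˡ (r ^ K) ⟨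
  1 * r ^ K                                 ∎
  where open ≡-Reasoning
length-tops r (suc M) K = begin
  length (tops r (suc M) K)                      ≡⟨ length-cartesianProductWith _∷_ (allFin (suc r)) (tops r M K) ⟩
  length (allFin (suc r)) * length (tops r M K)  ≡⟨ cong₂ _*_ (length-allFin (suc r)) (length-tops r M K) ⟩
  suc r * (suc r ^ M * r ^ K)                    ≡⟨ ℕₚ.*-assoc (suc r) (suc r ^ M) (r ^ K) ⟨
  suc r * suc r ^ M * r ^ K                      ∎
  where open ≡-Reasoning

-- Each of the `M` free positions takes the root value in one case out of `suc r`, the distinguished
-- one always, the last `K` never. Hence `rootClass` has mean `1 + M / suc r` over the list, and the
-- factor `suc r` clears the denominator.
∑-tops : ∀ r M K →
  ∑ (tops r M K) (rootClass ∘ lookup) * suc r ≡ suc r ^ M * r ^ K * (M + suc r)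
∑-tops r zero K = cong (_* suc r) (begin
  ∑ (map (fromℕ r ∷_) fs) (rootClass ∘ lookup)              ≡⟨ ∑-map (fromℕ r ∷_) fs (rootClass ∘ lookup) ⟩
  ∑ fs (λ f → rootClass (lookup (fromℕ r ∷ f)))             ≡⟨ ∑-cong fs (rootClass-∷ (fromℕ r)) ⟩
  ∑ fs (λ f → isLast (fromℕ r) + rootClass (lookup f))      ≡⟨ ∑-+ fs (λ _ → isLast (fromℕ r)) _ ⟩
  ∑ fs (λ _ → isLast (fromℕ r)) + ∑ fs (rootClass ∘ lookup) ≡⟨ cong₂ _+_ (∑-const fs _) (∑-avoiding r K) ⟩
  length fs * isLast (fromℕ r) + 0                          ≡⟨ cong₂ (λ a b → a * b + 0) (length-avoiding r K) (isLast-fromℕ r) ⟩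
  r ^ K * 1 + 0                                             ≡⟨ unit (r ^ K) ⟩
  1 * r ^ K                                                 ∎)
  where
  open ≡-Reasoning
  fs = avoiding r K
  unit : ∀ x → x * 1 + 0 ≡ 1 * x
  unit = solve-∀
∑-tops r (suc M) K = begin
  ∑ (tops r (suc M) K) (rootClass ∘ lookup) * q
    ≡⟨ cong (_* q) (∑-rootClass-∷ (allFin q) fs) ⟩
  (∑ (allFin q) isLast * length fs + length (allFin q) * w) * q
    ≡⟨ cong (_* q) (cong₂ _+_ (cong₂ _*_ (∑-isLast r) (length-tops r M K)) (cong (_* w) (length-allFin q))) ⟩
  (1 * (q ^ M * r ^ K) + q * w) * q
    ≡⟨ expand (q ^ M * r ^ K) q w ⟩
  q * (q ^ M * r ^ K) + q * (w * q)
    ≡⟨ cong (λ z → q * (q ^ M * r ^ K) + q * z) (∑-tops r M K) ⟩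
  q * (q ^ M * r ^ K) + q * (q ^ M * r ^ K * (M + q))
    ≡⟨ collect q (q ^ M) (r ^ K) M ⟩
  q * q ^ M * r ^ K * (suc M + q) ∎
  where
  open ≡-Reasoning
  q = suc r
  fs = tops r M K
  w = ∑ fs (rootClass ∘ lookup)
  expand : ∀ t q w → (1 * t + q * w) * q ≡ q * t + q * (w * q)
  expand = solve-∀
  collect : ∀ q x y M → q * (x * y) + q * (x * y * (M + q)) ≡ q * x * y * (suc M + q)
  collect = solve-∀

-- Acyclicity of forests by non-backtracking walks.

end : {V : Set} → V → List V → V
end x [] = x
end x (y ∷ ys) = end y ys

end-∷ʳ : {V : Set} (x : V) (ys : List V) (v : V) → end x (ys ∷ʳ v) ≡ v
end-∷ʳ x [] v = refl
end-∷ʳ x (y ∷ ys) v = end-∷ʳ y ys v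

end-∈ : {V : Set} (x : V) (ys : List V) → end x ys ∈ x ∷ ys
end-∈ x [] = here refl
end-∈ x (y ∷ ys) = there (end-∈ y ys)

beforeEnd : {V : Set} → V → V → List V → V
beforeEnd x y [] = x
beforeEnd x y (z ∷ zs) = beforeEnd y z zs

beforeEnd-∷ʳ : {V : Set} (x y : V) (zs : List V) (v : V) → beforeEnd x y (zs ∷ʳ v) ≡ end y zs
beforeEnd-∷ʳ x y [] v = refl
beforeEnd-∷ʳ x y (z ∷ zs) v = beforeEnd-∷ʳ y z zs v

data NonBacktracking {V : Set} : List V → Set where
  [-,-] : ∀ {x y} → NonBacktracking (x ∷ y ∷ [])
  _∷_ : ∀ {x y z zs} → x ≢ z → NonBacktracking (y ∷ z ∷ zs) → NonBacktracking (x ∷ y ∷ z ∷ zs)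

-- Uniqueness handles every triple of consecutive vertices but the last, which ends in `v`.
unique⇒nonBacktracking : ∀ {V : Set} {x y v : V} (zs : List V) → Unique (x ∷ y ∷ zs) →
  All (v ≢_) (x ∷ y ∷ zs) → NonBacktracking (x ∷ y ∷ (zs ∷ʳ v))
unique⇒nonBacktracking [] _ (v≢x ∷ _) = (v≢x ∘ sym) ∷ [-,-]
unique⇒nonBacktracking (z ∷ zs) ((_ ∷ x≢z ∷ _) ∷ u) (_ ∷ v≢) =
  x≢z ∷ unique⇒nonBacktracking zs u v≢

-- Once a non-backtracking walk in a forest steps away from the root, it must keep doing so.
module _ {V : Set} {R Parent : V → V → Set} (depth : V → ℕ)
  (orient : ∀ {u v} → R u v → Parent u v ⊎ Parent v u)
  (functional : ∀ {u v w} → Parent u v → Parent u w → v ≡ w)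
  (decreasing : ∀ {u v} → Parent u v → depth v < depth u) where

  descends : ∀ {x y} zs → Linked R (x ∷ y ∷ zs) → NonBacktracking (x ∷ y ∷ zs) → Parent y x →
    depth x < depth (end y zs) × Parent (end y zs) (beforeEnd x y zs)
  descends [] _ _ p = decreasing p , p
  descends (z ∷ zs) (_ ∷ l) (x≢z ∷ nb) p with orient (Linked.head l)
  -- A step back up would lead to the unique parent `x`, which is backtracking.
  ... | inj₁ q = ⊥-elim (x≢z (functional p q))
  ... | inj₂ q with <end , last ← descends zs l nb q = ℕₚ.<-trans (decreasing p) <end , last

  -- A walk that never turns loses depth throughout; one that turns keeps descending, so its last
  -- step goes from a parent to its child.
  ascends-or-descends : ∀ {x y} zs → Linked R (x ∷ y ∷ zs) → NonBacktracking (x ∷ y ∷ zs) →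
    depth (end y zs) < depth x ⊎ Parent (end y zs) (beforeEnd x y zs)
  ascends-or-descends zs (e ∷ l) nb with orient e
  ... | inj₂ p = inj₂ (proj₂ (descends zs (e ∷ l) nb p))
  ascends-or-descends [] (e ∷ l) nb | inj₁ p = inj₁ (decreasing p)
  ascends-or-descends (z ∷ zs) (e ∷ l) (_ ∷ nb) | inj₁ p with ascends-or-descends zs l nb
  ... | inj₁ end< = inj₁ (ℕₚ.<-trans end< (decreasing p))
  ... | inj₂ q = inj₂ q

  -- A cycle that only descends or only ascends would return to `v` at a different depth. One that
  -- ascends first and descends last has both cycle neighbours of `v` as the parent of `v`, so they
  -- coincide, against uniqueness.
  forest-acyclic : ∀ {v} ws → 2 ≤ length ws → Unique (v ∷ ws) → ¬ Linked R (v ∷ (ws ∷ʳ v))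
  forest-acyclic (_ ∷ []) (s≤s ())
  forest-acyclic {v} (w ∷ w′ ∷ ws) _ ((v≢w ∷ v≢w′ ∷ v≢ws) ∷ u@(w≢ ∷ _)) l@(e ∷ _)
    with nb ← v≢w′ ∷ unique⇒nonBacktracking ws u (v≢w ∷ v≢w′ ∷ v≢ws) | orient e
  ... | inj₂ p = ℕₚ.<-irrefl (cong depth (sym (end-∷ʳ w′ ws v))) (proj₁ (descends (w′ ∷ (ws ∷ʳ v)) l nb p))
  ... | inj₁ p with ascends-or-descends (w′ ∷ (ws ∷ʳ v)) l nb
  ...   | inj₁ end< = ℕₚ.<-irrefl (cong depth (end-∷ʳ w′ ws v)) end<
  ...   | inj₂ q = All.lookup w≢ (end-∈ w′ ws)
    (functional p (subst₂ Parent (end-∷ʳ w′ ws v) (beforeEnd-∷ʳ w w′ ws v) q))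

-- Paths, walks and adjacency.

data Path {m n} (E : EdgeSet m n) : Vertex m n → Vertex m n → List (Vertex m n) → Set where
  [] : ∀ {u} → Path E u u []
  _∷_ : ∀ {u w v ws} → Adj E u w → Path E w v ws → Path E u v (w ∷ ws)

path-suffix : {E : EdgeSet m n} {u w v : Vertex m n} {ws : List (Vertex m n)} →
  Path E w v ws → Unique (w ∷ ws) → u ∈ w ∷ ws → ∃[ ws′ ] (Path E u v ws′ × Unique (u ∷ ws′))
path-suffix p u (here refl) = _ , p , u
path-suffix (_ ∷ p) (_ ∷ u) (there i) = path-suffix p u i

-- If the new first vertex already lies on the path, only the suffix starting there is kept.
loop-erase : {E : EdgeSet m n} {u v : Vertex m n} → Walk E u v →
  ∃[ ws ] (Path E u v ws × Unique (u ∷ ws))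
loop-erase here = [] , [] , [] ∷ []
loop-erase {m} {n} {u = u} (step {v = w} e ω) with ws , p , uniq ← loop-erase ω
  with any? (u Finₚ.≟_) (w ∷ ws)
... | yes i = path-suffix p uniq i
... | no u∉ = w ∷ ws , e ∷ p , Allₚ.¬Any⇒All¬ (w ∷ ws) u∉ ∷ uniq

-- Two edge sets occur because the path will run in a subgraph while the closing edge belongs to the
-- larger graph.
path-closes : {E E′ : EdgeSet m n} {u v z : Vertex m n} {ws : List (Vertex m n)} →
  (∀ {x y} → Adj E x y → Adj E′ x y) → Path E u v ws → Adj E′ v z → Linked (Adj E′) (u ∷ (ws ∷ʳ z))
path-closes sub [] e = e ∷ [-]
path-closes sub (e′ ∷ []) e = sub e′ ∷ e ∷ [-]
path-closes sub (e′ ∷ p@(_ ∷ _)) e = sub e′ ∷ path-closes sub p e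

Adj'-sym : {E : EdgeSet m n} (s t : Fin m ⊎ Fin n) → Adj' E s t → Adj' E t s
Adj'-sym (inj₁ _) (inj₂ _) e = e
Adj'-sym (inj₂ _) (inj₁ _) e = e

Adj'-irreflexive : {E : EdgeSet m n} (s : Fin m ⊎ Fin n) → ¬ Adj' E s s
Adj'-irreflexive (inj₁ _) ()
Adj'-irreflexive (inj₂ _) ()

Adj'? : (E : EdgeSet m n) (s t : Fin m ⊎ Fin n) → Dec (Adj' E s t)
Adj'? E (inj₁ a) (inj₁ _) = no λ ()
Adj'? E (inj₁ a) (inj₂ b) = lookup (lookup E a) b Boolₚ.≟ true
Adj'? E (inj₂ b) (inj₁ a) = lookup (lookup E a) b Boolₚ.≟ true
Adj'? E (inj₂ b) (inj₂ _) = no λ ()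

Adj-join : {E : EdgeSet m n} (s t : Fin m ⊎ Fin n) → Adj' E s t → Adj E (join m n s) (join m n t)
Adj-join {m} {n} {E} s t = subst₂ (Adj' E) (sym (Finₚ.splitAt-join m n s)) (sym (Finₚ.splitAt-join m n t))

Adj-join⁻ : {E : EdgeSet m n} (s t : Fin m ⊎ Fin n) → Adj E (join m n s) (join m n t) → Adj' E s t
Adj-join⁻ {m} {n} {E} s t = subst₂ (Adj' E) (Finₚ.splitAt-join m n s) (Finₚ.splitAt-join m n t)

splitAt-injective : {u v : Fin (m + n)} → splitAt m u ≡ splitAt m v → u ≡ v
splitAt-injective {m} {n} {u} {v} eq = trans (sym (Finₚ.join-splitAt m n u))
  (trans (cong (join m n) eq) (Finₚ.join-splitAt m n v))

walk-trans : {E : EdgeSet m n} {u v w : Vertex m n} → Walk E u v → Walk E v w → Walk E u w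
walk-trans here ω = ω
walk-trans (step e ω′) ω = step e (walk-trans ω′ ω)

walk-sym : {E : EdgeSet m n} {u v : Vertex m n} → Walk E u v → Walk E v u
walk-sym here = here
walk-sym {m} (step {u} {v} e ω) =
  walk-trans (walk-sym ω) (step (Adj'-sym (splitAt m u) (splitAt m v) e) here)

-- From parent functions to a spanning tree.

par-fromℕ : (g : Vec (Fin m) r) → par g (fromℕ r) ≡ nothing
par-fromℕ [] = refl
par-fromℕ (a ∷ g) = par-fromℕ g

par-inject₁ : (g : Vec (Fin m) r) (j : Fin r) → par g (inject₁ j) ≡ just (lookup g j)
par-inject₁ (a ∷ g) zero = refl
par-inject₁ (a ∷ g) (suc j) = par-inject₁ g j

par-nothing : (g : Vec (Fin m) r) (b : Fin (suc r)) → par g b ≡ nothing → b ≡ fromℕ r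
par-nothing [] zero _ = refl
par-nothing (a ∷ g) (suc b) eq = cong suc (par-nothing g b eq)

Parent : Vec (Fin (suc r)) m → Vec (Fin m) r → Fin m ⊎ Fin (suc r) → Fin m ⊎ Fin (suc r) → Set
Parent f g (inj₁ a) (inj₂ b) = lookup f a ≡ b
Parent f g (inj₂ b) (inj₁ a) = par g b ≡ just a
Parent f g _ _ = ⊥

edge? : (f : Vec (Fin (suc r)) m) (g : Vec (Fin m) r) (a : Fin m) (b : Fin (suc r)) →
  Dec (lookup f a ≡ b ⊎ par g b ≡ just a)
edge? f g a b = (lookup f a Finₚ.≟ b) ⊎-dec Maybeₚ.≡-dec Finₚ._≟_ (par g b) (just a)

edges : Vec (Fin (suc r)) m → Vec (Fin m) r → EdgeSet m (suc r)
edges f g = Vec.tabulate λ a → Vec.tabulate λ b → does (edge? f g a b)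

lookup-tabulate₂ : {A : Set} (h : Fin m → Fin n → A) (a : Fin m) (b : Fin n) →
  lookup (lookup (Vec.tabulate λ a → Vec.tabulate (h a)) a) b ≡ h a b
lookup-tabulate₂ h a b = trans (cong (λ row → lookup row b) (Vecₚ.lookup∘tabulate (λ a → Vec.tabulate (h a)) a))
  (Vecₚ.lookup∘tabulate (h a) b)

from-does : {A : Set} (a? : Dec A) → does a? ≡ true → A
from-does (yes a) _ = a

module _ {m r} (f : Vec (Fin (suc r)) m) (g : Vec (Fin m) r) where

  edge⁺ : ∀ {a b} → lookup f a ≡ b ⊎ par g b ≡ just a → lookup (lookup (edges f g) a) b ≡ true
  edge⁺ {a} {b} e = trans (lookup-tabulate₂ (λ a b → does (edge? f g a b)) a b) (dec-true (edge? f g a b) e)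

  edge⁻ : ∀ {a b} → lookup (lookup (edges f g) a) b ≡ true → lookup f a ≡ b ⊎ par g b ≡ just a
  edge⁻ {a} {b} e = from-does (edge? f g a b)
    (trans (sym (lookup-tabulate₂ (λ a b → does (edge? f g a b)) a b)) e)

  Adj'⇒Parent : ∀ s t → Adj' (edges f g) s t → Parent f g s t ⊎ Parent f g t s
  Adj'⇒Parent (inj₁ a) (inj₂ b) e = edge⁻ e
  Adj'⇒Parent (inj₂ b) (inj₁ a) e = swap (edge⁻ e)

  Parent⇒Adj' : ∀ s t → Parent f g s t → Adj' (edges f g) s t
  Parent⇒Adj' (inj₁ a) (inj₂ b) p = edge⁺ (inj₁ p)
  Parent⇒Adj' (inj₂ b) (inj₁ a) p = edge⁺ (inj₂ p)

  Parent-functional : ∀ s t t′ → Parent f g s t → Parent f g s t′ → t ≡ t′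
  Parent-functional (inj₁ a) (inj₂ b) (inj₂ b′) p q = cong inj₂ (trans (sym p) q)
  Parent-functional (inj₂ b) (inj₁ a) (inj₁ a′) p q = cong inj₁ (Maybeₚ.just-injective (trans (sym p) q))

  root-orphan : ∀ s → ¬ Parent f g (inj₂ (fromℕ r)) s
  root-orphan (inj₁ a) p with () ← trans (sym (par-fromℕ g)) p

  -- The root has no parent, so an edge at the root can only come from `f`.
  last-edge : ∀ {a} → lookup (lookup (edges f g) a) (fromℕ r) ≡ true → lookup f a ≡ fromℕ r
  last-edge e with edge⁻ e
  ... | inj₁ p = p
  ... | inj₂ p with () ← trans (sym (par-fromℕ g)) p

  module _ (reach : ∀ b → Reach (lookup f) g b) where

    -- The distance to the root: every step of `Reach` crosses two edges, and a left vertex lies one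
    -- edge beyond its parent.
    depth : Fin m ⊎ Fin (suc r) → ℕ
    depth (inj₁ a) = suc (steps (reach (lookup f a)) * 2)
    depth (inj₂ b) = steps (reach b) * 2

    depth-decreasing : ∀ s t → Parent f g s t → depth t < depth s
    depth-decreasing (inj₁ a) (inj₂ b) refl = ℕₚ.≤-refl
    depth-decreasing (inj₂ b) (inj₁ a) p = ℕₚ.≤-reflexive
      (cong (_* 2) (steps-irrelevant (via p (reach (lookup f a))) (reach b)))

    edges-acyclic : ¬ HasCycle (edges f g)
    edges-acyclic (v , ws , 2≤ , uniq , l) = forest-acyclic {R = Adj (edges f g)}
      {Parent = λ u v → Parent f g (splitAt m u) (splitAt m v)} (depth ∘ splitAt m)
      (λ {u} {v} → Adj'⇒Parent (splitAt m u) (splitAt m v))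
      (λ {u} {v} {w} p q → splitAt-injective {m} (Parent-functional (splitAt m u) (splitAt m v) (splitAt m w) p q))
      (λ {u} {v} → depth-decreasing (splitAt m u) (splitAt m v))
      ws 2≤ uniq l

    right-walk : ∀ {b} → Reach (lookup f) g b →
      Walk (edges f g) (join m (suc r) (inj₂ b)) (join m (suc r) (inj₂ (fromℕ r)))
    right-walk {b} (root eq) with refl ← par-nothing g b eq = here
    right-walk {b} (via {a = a} eq ρ) =
      step (Adj-join (inj₂ b) (inj₁ a) (Parent⇒Adj' (inj₂ b) (inj₁ a) eq))
        (step (Adj-join (inj₁ a) (inj₂ (lookup f a)) (Parent⇒Adj' (inj₁ a) (inj₂ (lookup f a)) refl)) (right-walk ρ))

    walk-to-root : ∀ s → Walk (edges f g) (join m (suc r) s) (join m (suc r) (inj₂ (fromℕ r)))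
    walk-to-root (inj₁ a) =
      step (Adj-join (inj₁ a) (inj₂ (lookup f a)) (Parent⇒Adj' (inj₁ a) (inj₂ (lookup f a)) refl))
        (right-walk (reach (lookup f a)))
    walk-to-root (inj₂ b) = right-walk (reach b)

    edges-connected : Connected (edges f g)
    edges-connected u v = walk-trans (from u) (walk-sym (from v))
      where
      from : ∀ u → Walk (edges f g) u (join m (suc r) (inj₂ (fromℕ r)))
      from u = subst (λ u → Walk (edges f g) u _) (Finₚ.join-splitAt m (suc r) u) (walk-to-root (splitAt m u))

    has-parent : ∀ s → s ≢ inj₂ (fromℕ r) → ∃[ t ] Parent f g s t
    has-parent (inj₁ a) _ = inj₂ (lookup f a) , refl
    has-parent (inj₂ b) b≢ with view b
    ... | ‵fromℕ = ⊥-elim (b≢ refl)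
    ... | ‵inj₁ {i = j} _ = inj₁ (lookup g j) , par-inject₁ g j

-- The tree determines its parent functions.

vec-ext : {A : Set} {xs ys : Vec A n} → (∀ i → lookup xs i ≡ lookup ys i) → xs ≡ ys
vec-ext {xs = xs} {ys} eq = trans (sym (Vecₚ.tabulate∘lookup xs))
  (trans (Vecₚ.tabulate-cong eq) (Vecₚ.tabulate∘lookup ys))

module _ {m r} (f f′ : Vec (Fin (suc r)) m) (g g′ : Vec (Fin m) r)
  (reach : ∀ b → Reach (lookup f) g b) (same : edges f g ≡ edges f′ g′) where

  -- If the second tree reversed the edge from s to its parent t, then s would be the parent of t there,
  -- hence by induction on the depth also in the first tree.
  parents-agree : ∀ k s t → depth f g reach s < k → Parent f g s t → Parent f′ g′ s t
  parents-agree (suc k) s t (s≤s s<k) p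
    with Adj'⇒Parent f′ g′ s t (subst (λ E → Adj' E s t) same (Parent⇒Adj' f g s t p))
  ... | inj₁ q = q
  ... | inj₂ q = ⊥-elim (ℕₚ.<-asym t<s (depth-decreasing f g reach t s t→s))
    where
    t<s : depth f g reach t < depth f g reach s
    t<s = depth-decreasing f g reach s t p
    t≢root : t ≢ inj₂ (fromℕ r)
    t≢root refl = root-orphan f′ g′ s q
    t→s : Parent f g t s
    t→s with w , t→w ← has-parent f g reach t t≢root = subst (Parent f g t)
      (Parent-functional f′ g′ t w s (parents-agree k t w (ℕₚ.<-≤-trans t<s s<k) t→w) q) t→w

  edges-injective : f ≡ f′ × g ≡ g′
  edges-injective =
    vec-ext (λ a → sym (parents-agree (suc (depth f g reach (inj₁ a))) (inj₁ a) (inj₂ (lookup f a)) ℕₚ.≤-refl refl)) ,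
    vec-ext (λ j → sym (Maybeₚ.just-injective (trans (sym (par-inject₁ g′ j))
      (parents-agree (suc (depth f g reach (inj₂ (inject₁ j)))) (inj₂ (inject₁ j)) (inj₁ (lookup g j)) ℕₚ.≤-refl (par-inject₁ g j)))))

-- Shortest walks and the parent functions of a connected graph.

least : {P : ℕ → Set} → (∀ k → Dec (P k)) → ∀ k → P k → ∃[ l ] (P l × (∀ j → P j → l ≤ j))
least P? zero p = 0 , p , λ _ _ → z≤n
least {P} P? (suc k) p with P? 0
... | yes p₀ = 0 , p₀ , λ _ _ → z≤n
... | no ¬p₀ with l , pₗ , min ← least {P ∘ suc} (P? ∘ suc) k p =
  suc l , pₗ , λ { zero p₀ → ⊥-elim (¬p₀ p₀) ; (suc j) pⱼ → s≤s (min j pⱼ) }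

-- Defined by recursion on the length, so that existence of such a walk is decidable by searching
-- the finitely many next vertices.
WalkOfLength : EdgeSet m n → Vertex m n → ℕ → Vertex m n → Set
WalkOfLength E v zero u = u ≡ v
WalkOfLength E v (suc l) u = ∃[ w ] (Adj E u w × WalkOfLength E v l w)

walkOfLength? : (E : EdgeSet m n) (v : Vertex m n) (l : ℕ) (u : Vertex m n) → Dec (WalkOfLength E v l u)
walkOfLength? E v zero u = u Finₚ.≟ v
walkOfLength? {m} E v (suc l) u =
  Finₚ.any? λ w → Adj'? E (splitAt m u) (splitAt m w) ×-dec walkOfLength? E v l w

walk-length : {E : EdgeSet m n} {u v : Vertex m n} → Walk E u v → ∃[ l ] WalkOfLength E v l u
walk-length here = 0 , refl
walk-length (step e ω) with l , ω′ ← walk-length ω = suc l , _ , e , ω′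

module _ {m n} {E : EdgeSet m n} (connected : Connected E) (root : Fin m ⊎ Fin n) where

  shortest : ∀ u → ∃[ l ] (WalkOfLength E (join m n root) l u ×
    (∀ j → WalkOfLength E (join m n root) j u → l ≤ j))
  shortest u with l , ω ← walk-length (connected u (join m n root)) =
    least (λ l → walkOfLength? E (join m n root) l u) l ω

  distance : Fin m ⊎ Fin n → ℕ
  distance s = proj₁ (shortest (join m n s))

  -- The second vertex of a shortest walk to the root works: the rest of the walk bounds its
  -- distance.
  closer-neighbour : ∀ s → s ≢ root → ∃[ t ] (Adj' E s t × distance t < distance s)
  closer-neighbour s s≢root with shortest (join m n s)
  ... | zero , s≡root , _ = ⊥-elim (s≢root (trans (sym (Finₚ.splitAt-join m n s))
    (trans (cong (splitAt m) s≡root) (Finₚ.splitAt-join m n root))))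
  ... | suc l , (w , e , ω) , _ = splitAt m w ,
    subst (λ s → Adj' E s (splitAt m w)) (Finₚ.splitAt-join m n s) e ,
    s≤s (proj₂ (proj₂ (shortest _)) l
      (subst (WalkOfLength E (join m n root) l) (sym (Finₚ.join-splitAt m n w)) ω))

module _ {m r} {E : EdgeSet m (suc r)} (connected : Connected E) where

  private
    δ : Fin m ⊎ Fin (suc r) → ℕ
    δ = distance connected (inj₂ (fromℕ r))

  parent-of-left : ∀ a → ∃[ b ] (lookup (lookup E a) b ≡ true × δ (inj₂ b) < δ (inj₁ a))
  parent-of-left a with closer-neighbour connected (inj₂ (fromℕ r)) (inj₁ a) (λ ())
  ... | inj₂ b , e , lt = b , e , lt

  parent-of-right : ∀ j → ∃[ a ] (lookup (lookup E a) (inject₁ j) ≡ true × δ (inj₁ a) < δ (inj₂ (inject₁ j)))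
  parent-of-right j with closer-neighbour connected (inj₂ (fromℕ r)) (inj₂ (inject₁ j))
    (Finₚ.fromℕ≢inject₁ ∘ sym ∘ Sumₚ.inj₂-injective)
  ... | inj₁ a , e , lt = a , e , lt

  -- Together with `right-parents` this describes a breadth-first spanning tree of `E`; acyclicity
  -- will force it to be all of `E`.
  left-parents : Vec (Fin (suc r)) m
  left-parents = Vec.tabulate (proj₁ ∘ parent-of-left)

  right-parents : Vec (Fin m) r
  right-parents = Vec.tabulate (proj₁ ∘ parent-of-right)

  left-parent : ∀ a → lookup (lookup E a) (lookup left-parents a) ≡ true × δ (inj₂ (lookup left-parents a)) < δ (inj₁ a)
  left-parent a = subst (λ b → lookup (lookup E a) b ≡ true × δ (inj₂ b) < δ (inj₁ a))
    (sym (Vecₚ.lookup∘tabulate (proj₁ ∘ parent-of-left) a)) (proj₂ (parent-of-left a))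

  right-parent : ∀ j → lookup (lookup E (lookup right-parents j)) (inject₁ j) ≡ true ×
    δ (inj₁ (lookup right-parents j)) < δ (inj₂ (inject₁ j))
  right-parent j = subst (λ a → lookup (lookup E a) (inject₁ j) ≡ true × δ (inj₁ a) < δ (inj₂ (inject₁ j)))
    (sym (Vecₚ.lookup∘tabulate (proj₁ ∘ parent-of-right) j)) (proj₂ (parent-of-right j))

  -- Passing to a parent lowers the distance to the root, so induction on the bound `k` terminates.
  parents-reach : ∀ k b → δ (inj₂ b) < k → Reach (lookup left-parents) right-parents b
  parents-reach (suc k) b (s≤s δ≤k) with view b
  ... | ‵fromℕ = root (par-fromℕ right-parents)
  ... | ‵inj₁ {i = j} _ = via (par-inject₁ right-parents j) (parents-reach k _
    (ℕₚ.<-trans (proj₂ (left-parent (lookup right-parents j))) (ℕₚ.<-≤-trans (proj₂ (right-parent j)) δ≤k)))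

  parent-edges⊆ : ∀ a b → lookup left-parents a ≡ b ⊎ par right-parents b ≡ just a → lookup (lookup E a) b ≡ true
  parent-edges⊆ a b (inj₁ refl) = proj₁ (left-parent a)
  parent-edges⊆ a b (inj₂ p) with view b
  ... | ‵fromℕ with () ← trans (sym (par-fromℕ right-parents)) p
  parent-edges⊆ a b (inj₂ p) | ‵inj₁ {i = j} _
    with refl ← Maybeₚ.just-injective (trans (sym (par-inject₁ right-parents j)) p) = proj₁ (right-parent j)

-- Every spanning tree comes from parent functions.

extra-edge⇒cycle : {E E′ : EdgeSet m n} → (∀ s t → Adj' E s t → Adj' E′ s t) → Connected E →
  ∀ s t → Adj' E′ s t → ¬ Adj' E s t → HasCycle E′
extra-edge⇒cycle {m} {n} {E} {E′} sub connected s t e ¬e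
  with loop-erase (connected (join m n s) (join m n t))
... | ws , p , uniq = join m n s , ws , long p refl refl , uniq ,
  path-closes (λ {x} {y} → sub (splitAt m x) (splitAt m y)) p (Adj-join t s (Adj'-sym s t e))
  where
  -- The path has at least two edges: with none, `s` and `t` would coincide and be adjacent; with
  -- one, the extra edge would lie in `E`.
  long : ∀ {u v ws} → Path E u v ws → u ≡ join m n s → v ≡ join m n t → 2 ≤ length ws
  long [] u≡ v≡ = ⊥-elim (Adj'-irreflexive t (subst (λ s → Adj' E′ s t)
    (trans (sym (Finₚ.splitAt-join m n s)) (trans (cong (splitAt m) (trans (sym u≡) v≡)) (Finₚ.splitAt-join m n t))) e))
  long (e′ ∷ []) refl refl = ⊥-elim (¬e (Adj-join⁻ s t e′))
  long (_ ∷ _ ∷ _) _ _ = s≤s (s≤s z≤n)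

-- The edges to parents form a connected subgraph of `E`, and any further edge of `E` would close a
-- cycle with it.
spanningTree⇒edges : {E : EdgeSet m (suc r)} → IsSpanningTree E →
  ∃[ f ] ∃[ g ] ((∀ b → Reach (lookup f) g b) × E ≡ edges f g)
spanningTree⇒edges {m} {r} {E} (connected , acyclic) = f , g , reach ,
  vec-ext (λ a → vec-ext λ b → sym (Boolₚ.⇔→≡ {z = true} (mk⇔ (parent-edges⊆ connected a b ∘ edge⁻ f g) (edge⊇ a b))))
  where
  f = left-parents connected
  g = right-parents connected
  reach : ∀ b → Reach (lookup f) g b
  reach b = parents-reach connected _ b ℕₚ.≤-refl
  sub : ∀ s t → Adj' (edges f g) s t → Adj' E s t
  sub (inj₁ a) (inj₂ b) e = parent-edges⊆ connected a b (edge⁻ f g e)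
  sub (inj₂ b) (inj₁ a) e = parent-edges⊆ connected a b (edge⁻ f g e)
  edge⊇ : ∀ a b → lookup (lookup E a) b ≡ true → lookup (lookup (edges f g) a) b ≡ true
  edge⊇ a b e with Adj'? (edges f g) (inj₁ a) (inj₂ b)
  ... | yes e′ = e′
  ... | no ¬e = ⊥-elim (acyclic (extra-edge⇒cycle sub (edges-connected f g reach) (inj₁ a) (inj₂ b) e ¬e))

-- Prescribing the highest child of the root.

avoiding-sound : ∀ K {f} → f ∈ avoiding r K → ∀ a → lookup f a ≢ fromℕ r
avoiding-sound {r} (suc K) f∈
  with _ , _ , p , q , refl ← ∈-cartesianProductWith⁻ _∷_ (map inject₁ (allFin r)) (avoiding r K) f∈
  with _ , _ , refl ← ∈-map⁻ inject₁ p
  = λ { zero → Finₚ.fromℕ≢inject₁ ∘ sym ; (suc a) → avoiding-sound K q a }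

avoiding-complete : ∀ K f → (∀ a → lookup f a ≢ fromℕ r) → f ∈ avoiding r K
avoiding-complete zero [] _ = here refl
avoiding-complete (suc K) (x ∷ f) avoids with view x
... | ‵fromℕ = ⊥-elim (avoids zero refl)
... | ‵inj₁ {i = j} _ =
  ∈-cartesianProductWith⁺ _∷_ (∈-map⁺ inject₁ (∈-allFin j)) (avoiding-complete K f (avoids ∘ suc))

-- With m equal to `M + suc K` and k equal to `suc K`, the vertex m + 1 - k has the zero-based index
-- `M`.
IsTop : ∀ M K → Vec (Fin (suc r)) (M + suc K) → Set
IsTop {r} M K f = lookup f (M ↑ʳ zero) ≡ fromℕ r × (∀ a → lookup f a ≡ fromℕ r → toℕ a ≤ M)

tops-sound : ∀ M K {f} → f ∈ tops r M K → IsTop M K f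
tops-sound zero K f∈ with _ , p , refl ← ∈-map⁻ _ f∈ =
  refl , λ { zero _ → z≤n ; (suc a) eq → ⊥-elim (avoiding-sound K p a eq) }
tops-sound {r} (suc M) K f∈
  with _ , _ , _ , q , refl ← ∈-cartesianProductWith⁻ _∷_ (allFin (suc r)) (tops r M K) f∈
  with top , below ← tops-sound M K q
  = top , λ { zero _ → z≤n ; (suc a) eq → s≤s (below a eq) }

tops-complete : ∀ M K f → IsTop M K f → f ∈ tops r M K
tops-complete zero K (_ ∷ f) (refl , below) =
  ∈-map⁺ _ (avoiding-complete K f λ a eq → ℕₚ.1+n≰n (ℕₚ.≤-trans (below (suc a) eq) z≤n))
tops-complete (suc M) K (x ∷ f) (top , below) =
  ∈-cartesianProductWith⁺ _∷_ (∈-allFin x) (tops-complete M K f (top , λ a eq → ℕₚ.≤-pred (below (suc a) eq)))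

HasTop : ∀ M K → EdgeSet (M + suc K) (suc r) → Set
HasTop {r} M K E = lookup (lookup E (M ↑ʳ zero)) (fromℕ r) ≡ true ×
  (∀ a → lookup (lookup E a) (fromℕ r) ≡ true → toℕ a ≤ M)

-- Enumeration of the trees and their number.

module _ (r M K : ℕ) where

  private
    m₀ = M + suc K
    ρ : Fin (m₀ + suc r)
    ρ = join m₀ (suc r) (inj₂ (fromℕ r))
    κ : Fin (m₀ + suc r)
    κ = join m₀ (suc r) (inj₁ (M ↑ʳ zero))

  toℕ-root : toℕ ρ ≡ (m₀ + suc r) ∸ 1
  toℕ-root = begin
    toℕ (m₀ ↑ʳ fromℕ r)        ≡⟨ Finₚ.toℕ-↑ʳ m₀ (fromℕ r) ⟩
    m₀ + toℕ (fromℕ r)         ≡⟨ cong (m₀ +_) (Finₚ.toℕ-fromℕ r) ⟩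
    m₀ + r                     ≡⟨ cong (_∸ 1) (ℕₚ.+-suc m₀ r) ⟨
    (m₀ + suc r) ∸ 1           ∎
    where open ≡-Reasoning

  toℕ-top : toℕ κ ≡ m₀ ∸ suc K
  toℕ-top = begin
    toℕ ((M ↑ʳ zero {K}) ↑ˡ suc r)    ≡⟨ Finₚ.toℕ-↑ˡ (M ↑ʳ zero {K}) (suc r) ⟩
    toℕ (M ↑ʳ zero {K})               ≡⟨ Finₚ.toℕ-↑ʳ M (zero {K}) ⟩
    M + 0                             ≡⟨ ℕₚ.+-identityʳ M ⟩
    M                                 ≡⟨ ℕₚ.m+n∸n≡m M (suc K) ⟨
    m₀ ∸ suc K                        ∎
    where open ≡-Reasoning

  InT⇒HasTop : {E : EdgeSet m₀ (suc r)} → InT m₀ (suc r) (suc K) E → IsSpanningTree E × HasTop M K E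
  InT⇒HasTop {E} (spanning , u , v , u≡ , v≡ , _ , adj , highest)
    -- The root and the child in `InT` are known by their numbers only, which identify them with `ρ`
    -- and `κ`.
    with refl ← Finₚ.toℕ-injective (trans u≡ (sym toℕ-root))
    with refl ← Finₚ.toℕ-injective (trans v≡ (sym toℕ-top))
    = spanning , Adj-join⁻ {E = E} (inj₂ (fromℕ r)) (inj₁ (M ↑ʳ zero)) adj , λ a e →
      subst₂ _≤_ (Finₚ.toℕ-↑ˡ a (suc r)) (trans v≡ (ℕₚ.m+n∸n≡m M (suc K)))
        (highest (a ↑ˡ suc r) (Adj-join {E = E} (inj₂ (fromℕ r)) (inj₁ a) e))

  HasTop⇒InT : {E : EdgeSet m₀ (suc r)} → IsSpanningTree E → HasTop M K E → InT m₀ (suc r) (suc K) E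
  HasTop⇒InT {E} spanning (top , below) =
    spanning , ρ , κ , toℕ-root , toℕ-top , uprooted , Adj-join {E = E} (inj₂ (fromℕ r)) (inj₁ (M ↑ʳ zero)) top , highest
    where
    -- All neighbours of the root are left vertices; this gives `uprooted` and reduces `highest` to
    -- `below`.
    left-neighbour : ∀ v → Adj E ρ v → ∃[ a ] (toℕ v ≡ toℕ a × lookup (lookup E a) (fromℕ r) ≡ true)
    left-neighbour v e with splitAt m₀ v in eq | subst (λ s → Adj' E s (splitAt m₀ v)) (Finₚ.splitAt-join m₀ (suc r) (inj₂ (fromℕ r))) e
    ... | inj₁ a | e′ = a , trans (cong toℕ (sym (Finₚ.splitAt⁻¹-↑ˡ eq))) (Finₚ.toℕ-↑ˡ a (suc r)) , e′
    uprooted : Uprooted E ρ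
    uprooted v e with a , v≡a , _ ← left-neighbour v e =
      subst₂ _<_ (sym v≡a) (sym (Finₚ.toℕ-↑ʳ m₀ (fromℕ r))) (ℕₚ.<-≤-trans (Finₚ.toℕ<n a) (ℕₚ.m≤m+n m₀ _))
    highest : ∀ v → Adj E ρ v → toℕ v ≤ toℕ κ
    highest v e with a , v≡a , e′ ← left-neighbour v e =
      subst₂ _≤_ (sym v≡a) (sym (trans toℕ-top (ℕₚ.m+n∸n≡m M (suc K)))) (below a e′)

  treesOver : Vec (Fin (suc r)) m₀ → List (EdgeSet m₀ (suc r))
  treesOver f = map (edges f) (goods (lookup f))

  trees : List (EdgeSet m₀ (suc r))
  trees = concatMap treesOver (tops r M K)

  treesOver-unique : ∀ f → Unique (treesOver f)
  treesOver-unique f = map-unique (λ {g} {g′} p _ eq → proj₂ (edges-injective f f g g′ (goods-sound (lookup f) p) eq))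
    (goods-unique (lookup f))

  treesOver-disjoint : ∀ {f f′ E} → E ∈ treesOver f → E ∈ treesOver f′ → f ≡ f′
  treesOver-disjoint {f} {f′} p q with g , g∈ , refl ← ∈-map⁻ (edges f) p | g′ , _ , eq ← ∈-map⁻ (edges f′) q =
    proj₁ (edges-injective f f′ g g′ (goods-sound (lookup f) g∈) eq)

  trees-unique : Unique trees
  trees-unique = concatMap-unique treesOver-unique treesOver-disjoint (tops-unique r M K)

  trees-sound : ∀ {E} → E ∈ trees → InT m₀ (suc r) (suc K) E
  trees-sound E∈
    with f , f∈ , p ← find (∈-concatMap⁻ treesOver {xs = tops r M K} E∈)
    with g , g∈ , refl ← ∈-map⁻ (edges f) p
    with top , below ← tops-sound M K f∈
    = HasTop⇒InT (edges-connected f g reach , edges-acyclic f g reach)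
        (edge⁺ f g (inj₁ top) , λ a e → below a (last-edge f g e))
    where
    reach : ∀ b → Reach (lookup f) g b
    reach = goods-sound (lookup f) g∈

  trees-complete : ∀ {E} → InT m₀ (suc r) (suc K) E → E ∈ trees
  trees-complete E∈T with spanning , top , below ← InT⇒HasTop E∈T
    with f , g , reach , refl ← spanningTree⇒edges spanning
    = ∈-concatMap⁺ treesOver (lose
        (tops-complete M K f (last-edge f g top , λ a eq → below a (edge⁺ f g (inj₁ eq))))
        (∈-map⁺ (edges f) (goods-complete (lookup f) g reach)))

  -- The factors `m₀` and `suc r` are those that clear denominators in `length-goods` and `∑-tops`.
  length-trees : length trees * m₀ * suc r ≡ m₀ ^ r * suc r ^ M * r ^ K * (M + suc r)
  length-trees = begin
    length trees * m₀ * suc r                                  ≡⟨ cong (λ l → l * m₀ * suc r) (length-concatMap treesOver fs) ⟩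
    ∑ fs (length ∘ treesOver) * m₀ * suc r                     ≡⟨ cong (_* suc r) (∑-*ʳ fs _ m₀) ⟨
    ∑ fs (λ f → length (treesOver f) * m₀) * suc r             ≡⟨ cong (_* suc r) (∑-cong fs length-treesOver) ⟩
    ∑ fs (λ f → rootClass (lookup f) * m₀ ^ r) * suc r         ≡⟨ cong (_* suc r) (∑-*ʳ fs _ (m₀ ^ r)) ⟩
    ∑ fs (rootClass ∘ lookup) * m₀ ^ r * suc r                 ≡⟨ swap-last (∑ fs (rootClass ∘ lookup)) (m₀ ^ r) (suc r) ⟩
    m₀ ^ r * (∑ fs (rootClass ∘ lookup) * suc r)               ≡⟨ cong (m₀ ^ r *_) (∑-tops r M K) ⟩
    m₀ ^ r * (suc r ^ M * r ^ K * (M + suc r))                 ≡⟨ reassociate (m₀ ^ r) (suc r ^ M) (r ^ K) (M + suc r) ⟩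
    m₀ ^ r * suc r ^ M * r ^ K * (M + suc r)                   ∎
    where
    open ≡-Reasoning
    fs = tops r M K
    length-treesOver : ∀ f → length (treesOver f) * m₀ ≡ rootClass (lookup f) * m₀ ^ r
    length-treesOver f = trans (cong (_* m₀) (Listₚ.length-map (edges f) (goods (lookup f)))) (length-goods (lookup f))
    swap-last : ∀ a b c → a * b * c ≡ b * (a * c)
    swap-last = solve-∀
    reassociate : ∀ a b c d → a * (b * c * d) ≡ a * b * c * d
    reassociate = solve-∀

-- From an enumeration to a bijection, and the final count.

lookup-injective : {A : Set} {xs : List A} → Unique xs → ∀ i j → List.lookup xs i ≡ List.lookup xs j → i ≡ j
lookup-injective (_ ∷ _) zero zero _ = refl
lookup-injective (x∉ ∷ _) zero (suc j) eq = ⊥-elim (All.lookup x∉ (∈-lookup j) eq)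
lookup-injective (x∉ ∷ _) (suc i) zero eq = ⊥-elim (All.lookup x∉ (∈-lookup i) (sym eq))
lookup-injective (_ ∷ u) (suc i) (suc j) eq = cong suc (lookup-injective u i j eq)

module _ {m n k : ℕ} (L : List (EdgeSet m n)) (unique : Unique L)
  (sound : ∀ {E} → E ∈ L → InT m n k E) (complete : ∀ {E} → InT m n k E → E ∈ L) where

  private
    open DecMembership (Vecₚ.≡-dec {n = m} (Vecₚ.≡-dec {n = n} Boolₚ._≟_)) using (_∈?_)

    located : (t : 𝔗 m n k) → 𝔗.edges t ∈ L
    -- `isIn` is irrelevant, so membership in `L` is recovered by deciding it.
    located (tree E isIn) = recompute (E ∈? L) (complete isIn)

    position : 𝔗 m n k → Fin (length L)
    position t = index (located t)

    lookup-position : ∀ t → 𝔗.edges t ≡ List.lookup L (position t)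
    lookup-position t = lookup-index (located t)

    edges-determine : {s t : 𝔗 m n k} → 𝔗.edges s ≡ 𝔗.edges t → s ≡ t
    edges-determine refl = refl

  enumeration⇒bijection : 𝔗 m n k ⤖ Fin (length L)
  enumeration⇒bijection = mk⤖ {to = position} (position-injective , position-surjective)
    where
    position-injective : ∀ {s t} → position s ≡ position t → s ≡ t
    position-injective {s} {t} eq = edges-determine
      (trans (lookup-position s) (trans (cong (List.lookup L) eq) (sym (lookup-position t))))
    position-surjective : ∀ i → ∃[ t ] (∀ {s} → s ≡ t → position s ≡ i)
    position-surjective i = tree (List.lookup L i) (sound (∈-lookup i)) ,
      λ { refl → lookup-injective unique _ i (sym (lookup-position (tree (List.lookup L i) (sound (∈-lookup i))))) }

-- The exponents n - 2 and m - k - 1 can be -1, so the formula is stated multiplied by m * n, which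
-- is nonzero.
theorem3p1 : (m n k : ℕ) → 1 ≤ m → 1 ≤ n → 1 ≤ k → k ≤ m →
    ∃[ N ] ((𝔗 m n k ⤖ Fin N) ×
    N * m * n ≡ m ^ (n ∸ 1) * n ^ (m ∸ k) * (n ∸ 1) ^ (k ∸ 1) * (m + n ∸ k))
theorem3p1 m (suc r) (suc K) _ _ _ k≤m =
  -- By `k≤m`, m has the form `M + suc K` with `M` equal to m - k, the shape that `tops` is built
  -- on.
  subst Claim (ℕₚ.m∸n+n≡m k≤m) (claim (m ∸ suc K))
  where
  Claim : ℕ → Set
  Claim m = ∃[ N ] ((𝔗 m (suc r) (suc K) ⤖ Fin N) ×
    N * m * suc r ≡ m ^ r * suc r ^ (m ∸ suc K) * r ^ K * (m + suc r ∸ suc K))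
  claim : ∀ M → Claim (M + suc K)
  claim M = length (trees r M K) ,
    enumeration⇒bijection (trees r M K) (trees-unique r M K) (trees-sound r M K) (trees-complete r M K) ,
    trans (length-trees r M K) (cong₂ (λ e t → (M + suc K) ^ r * suc r ^ e * r ^ K * t)
      (sym (ℕₚ.m+n∸n≡m M (suc K))) (sym total))
    where
    open ≡-Reasoning
    swap-last : ∀ a b c → a + b + c ≡ a + c + b
    swap-last = solve-∀
    total : M + suc K + suc r ∸ suc K ≡ M + suc r
    total = begin
      M + suc K + suc r ∸ suc K    ≡⟨ cong (_∸ suc K) (swap-last M (suc K) (suc r)) ⟩
      M + suc r + suc K ∸ suc K    ≡⟨ ℕₚ.m+n∸n≡m (M + suc r) (suc K) ⟩
      M + suc r                    ∎
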